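{- Let $A$ be a finite set of agents with $|A|\ge 2$ and $\mathsf{Prop}$ a countable set of propositional variables. For every formula $\varphi\in\mathcal{L}_{KS}$: if $\varphi$ is valid on the class of all simplicial secrecy models (true at every facet of every simplicial secrecy model), then $\vdash_{\mathsf{SSL}}\varphi$.
   Context: A simplicial complex is a pair $(V,\mathcal{F})$ with $V$ a non-empty set and $\mathcal{F}$ a non-empty family of finite non-empty subsets of $V$ (faces), closed under non-empty subsets. A facet is an inclusion-maximal face; $\mathrm{Fac}$ denotes the set of facets. An $A$-chromatic simplicial complex is $(V,\mathcal{F},\chi)$ with $\chi:V\to A$ injective on every face. An $A$-chromatic simplicial epistemic model is $(V,\mathcal{F},\chi,\nu)$ where $(V,\mathcal{F},\chi)$ is $A$-chromatic, every facet $X$ satisfies $\chi[X]=A$, every vertex lies in some facet, and $\nu:\mathrm{Fac}\to\mathcal{P}(\mathsf{Prop})$. For a facet $X$ and $a\in A$, $v_a(X)$ is the unique vertex of colour $a$ in $X$; for a vertex $v$, $\mathrm{St}(v)=\{X\in\mathrm{Fac}: v\in X\}$; $X\sim_a Y$ iff $v_a(X)=v_a(Y)$. A simplicial secrecy model is $M=(V,\mathcal{F},\chi,\nu,\{N^S_a\}_{a\in A})$ where $(V,\mathcal{F},\chi,\nu)$ is such a model and, with $V_a=\{v:\chi(v)=a\}$, each $N_a^S:V_a\to\mathcal{P}(\mathcal{P}(\mathrm{Fac}(M)))$ satisfies (SN): for every $a$, $v\in V_a$, $U\in N_a^S(v)$, every $X\in\mathrm{St}(v)$ and every $b\in A\setminus\{a\}$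 there is a facet $Y$ with $X\sim_b Y$ and $Y\notin U$. The language $\mathcal{L}_{KS}$ is $\varphi::=p\mid\neg\varphi\mid(\varphi\wedge\varphi)\mid K_a\varphi\mid S_a\varphi$ ($p\in\mathsf{Prop}$, $a\in A$). Truth at facets: $M,X\Vdash p$ iff $p\in\nu(X)$; Boolean clauses as usual; $M,X\Vdash K_a\varphi$ iff $M,Y\Vdash\varphi$ for all facets $Y$ with $X\sim_a Y$; $M,X\Vdash S_a\varphi$ iff $M,X\Vdash K_a\varphi$ and $[\![\varphi]\!]\in N_a^S(v_a(X))$, where $[\![\varphi]\!]=\{Y\in\mathrm{Fac}(M):M,Y\Vdash\varphi\}$. The system $\mathsf{SSL}$ has axioms: all propositional tautologies; for each $a\in A$: (K) $K_a(\varphi\to\psi)\to(K_a\varphi\to K_a\psi)$, (T) $K_a\varphi\to\varphi$, (4) $K_a\varphi\to K_aK_a\varphi$, (5) $\neg K_a\varphi\to K_a\neg K_a\varphi$, (S1) $S_a\varphi\to K_a\varphi$, (S4) $S_a\varphi\to K_aS_a\varphi$; and for distinct $a,b\in A$: (S2) $S_a\varphi\to\neg K_b\varphi$. Rules: modus ponens; from $\varphi$ infer $K_a\varphi$; from $\vdash\varphi\leftrightarrow\psi$ infer $\vdash S_a\varphi\leftrightarrow S_a\psi$. -}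

module Defs where

open import Data.Nat using (ℕ; _≤_)
open import Data.Fin using (Fin)
open import Data.Bool using (Bool; true; false; not; _∧_)
open import Data.List using (List; [])
open import Data.List.Membership.Propositional using (_∈_)
open import Data.List.Relation.Binary.Subset.Propositional using (_⊆_)
open import Data.Product using (Σ; _×_; _,_; proj₁; proj₂)
open import Relation.Binary.PropositionalEquality using (_≡_; _≢_)
open import Relation.Nullary using (¬_)

Countable : Set → Set
Countable P = Σ (P → ℕ) (λ f → ∀ {x y} → f x ≡ f y → x ≡ y)

data Fm (Ag P : Set) : Set where
  var : P → Fm Ag P
  neg : Fm Ag P → Fm Ag P
  _and_ : Fm Ag P → Fm Ag P → Fm Ag P
  K : Ag → Fm Ag P → Fm Ag P
  S : Ag → Fm Ag P → Fm Ag P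

module _ {Ag P : Set} where

  _imp_ : Fm Ag P → Fm Ag P → Fm Ag P
  φ imp ψ = neg (φ and neg ψ)

  _iff_ : Fm Ag P → Fm Ag P → Fm Ag P
  φ iff ψ = (φ imp ψ) and (ψ imp φ)

  evalB : (Fm Ag P → Bool) → Fm Ag P → Bool
  evalB g (var p) = g (var p)
  evalB g (neg φ) = not (evalB g φ)
  evalB g (φ and ψ) = evalB g φ ∧ evalB g ψ
  evalB g (K a φ) = g (K a φ)
  evalB g (S a φ) = g (S a φ)

  Tautology : Fm Ag P → Set
  Tautology φ = ∀ (g : Fm Ag P → Bool) → evalB g φ ≡ true

data SSL⊢ {Ag P : Set} : Fm Ag P → Set where
  taut : ∀ {φ} → Tautology φ → SSL⊢ φ
  axK  : ∀ a φ ψ → SSL⊢ (K a (φ imp ψ) imp (K a φ imp K a ψ))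
  axT  : ∀ a φ → SSL⊢ (K a φ imp φ)
  ax4  : ∀ a φ → SSL⊢ (K a φ imp K a (K a φ))
  ax5  : ∀ a φ → SSL⊢ (neg (K a φ) imp K a (neg (K a φ)))
  axS1 : ∀ a φ → SSL⊢ (S a φ imp K a φ)
  axS4 : ∀ a φ → SSL⊢ (S a φ imp K a (S a φ))
  axS2 : ∀ a b φ → a ≢ b → SSL⊢ (S a φ imp neg (K b φ))
  mp   : ∀ {φ ψ} → SSL⊢ (φ imp ψ) → SSL⊢ φ → SSL⊢ ψ
  nec  : ∀ a {φ} → SSL⊢ φ → SSL⊢ (K a φ)
  reS  : ∀ a {φ ψ} → SSL⊢ (φ iff ψ) → SSL⊢ (S a φ iff S a ψ)

-- Simplicial complexes. Faces are finite subsets of V, represented by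
-- lists (read as the set of their elements; duplicates/order irrelevant).

record SimplicialComplex (V : Set) : Set₁ where
  field
    inhabited     : V
    Face          : List V → Set
    face-exists   : Σ (List V) Face
    face-nonempty : ∀ {xs} → Face xs → xs ≢ []
    face-closed   : ∀ {xs ys} → Face xs → ys ≢ [] → ys ⊆ xs → Face ys

  IsFacet : List V → Set
  IsFacet xs = Face xs × (∀ ys → Face ys → xs ⊆ ys → ys ⊆ xs)

  Fac : Set
  Fac = Σ (List V) IsFacet

  SameFacet : Fac → Fac → Set
  SameFacet X Y = (proj₁ X ⊆ proj₁ Y) × (proj₁ Y ⊆ proj₁ X)

  St : V → Fac → Set
  St v X = v ∈ proj₁ X

record ChromaticComplex (Ag V : Set) : Set₁ where
  field
    complex : SimplicialComplex V
  open SimplicialComplex complex public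
  field
    χ     : V → Ag
    χ-inj : ∀ {xs u v} → Face xs → u ∈ xs → v ∈ xs → χ u ≡ χ v → u ≡ v

record EpistemicModel (Ag P V : Set) : Set₁ where
  field
    chromatic : ChromaticComplex Ag V
  open ChromaticComplex chromatic public
  field
    facet-colours : ∀ (X : Fac) (a : Ag) → Σ V (λ v → (v ∈ proj₁ X) × (χ v ≡ a))
    vertex-facet  : ∀ (v : V) → Σ Fac (λ X → v ∈ proj₁ X)
    ν             : Fac → P → Set
    ν-ext         : ∀ X Y → SameFacet X Y → ∀ p → ν X p → ν Y p

  -- v_a(X): the (unique, by χ-inj) vertex of colour a in X
  vtx : Ag → Fac → V
  vtx a X = proj₁ (facet-colours X a)

  vtx-colour : ∀ a X → χ (vtx a X) ≡ a
  vtx-colour a X = proj₂ (proj₂ (facet-colours X a))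

  _∼[_]_ : Fac → Ag → Fac → Set
  X ∼[ a ] Y = vtx a X ≡ vtx a Y

record SecrecyModel (Ag P V : Set) : Set₁ where
  field
    epistemic : EpistemicModel Ag P V
  open EpistemicModel epistemic public
  field
    -- N^S_a : V_a → P(P(Fac)); subsets of Fac are predicates on Fac
    N     : (a : Ag) (v : V) → χ v ≡ a → (Fac → Set) → Set
    -- N^S_a(v) is a family of *sets*: closed under extensional equality
    N-ext : ∀ a v (c : χ v ≡ a) (U U' : Fac → Set) →
            (∀ Y → U Y → U' Y) → (∀ Y → U' Y → U Y) → N a v c U → N a v c U'
    SN    : ∀ a v (c : χ v ≡ a) (U : Fac → Set) → N a v c U →
            ∀ (X : Fac) → St v X → ∀ b → b ≢ a →
            Σ Fac (λ Y → (X ∼[ b ] Y) × ¬ U Y)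

module _ {Ag P V : Set} (M : SecrecyModel Ag P V) where
  open SecrecyModel M

  _⊩_ : Fac → Fm Ag P → Set
  X ⊩ var p = ν X p
  X ⊩ neg φ = ¬ (X ⊩ φ)
  X ⊩ (φ and ψ) = (X ⊩ φ) × (X ⊩ ψ)
  X ⊩ K a φ = ∀ Y → X ∼[ a ] Y → Y ⊩ φ
  X ⊩ S a φ = (∀ Y → X ∼[ a ] Y → Y ⊩ φ) × N a (vtx a X) (vtx-colour a X) (λ Y → Y ⊩ φ)

Valid : {Ag P : Set} → Fm Ag P → Set₁
Valid {Ag} {P} φ = ∀ (V : Set) (M : SecrecyModel Ag P V) (X : SecrecyModel.Fac M) → _⊩_ M X φ

{-# OPTIONS --safe #-}
-- Idea.  Worlds are Boolean valuations of the modal atoms in a finite closure Γ of φ.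
-- Starting from all of them, repeatedly delete the valuations that violate some theorem
-- over Γ (an axiom instance, or a theorem forced by the absence of a witness among the
-- remaining valuations).  The invariant is that every formula over Γ true at all the
-- remaining valuations is derivable.  When nothing more is deleted, either φ is true at
-- all of them, hence derivable, or they carry a countermodel.  There, agent a does not
-- distinguish valuations that agree on the formulas K a ψ and S a ψ of Γ.  To get a
-- simplicial model, where a facet is determined by its vertices, each world i is paired
-- with an integer t: the first agent sees t and the others see t + i, so that two agents
-- together determine (i , t), while each single agent can reach every world that it
-- considers possible.
module Submission where

open import Defs
open import Data.Nat using (ℕ; suc; _≤_; _<_; s≤s)
import Data.Nat.Properties as ℕ
open import Data.Nat.Induction using (<-wellFounded)
open import Induction.WellFounded using (Acc; acc)
open import Data.Fin using (Fin; zero; suc; toℕ)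
open import Data.Fin.Properties using (any?; toℕ-injective) renaming (_≟_ to _≟ᶠ_)
open import Data.Bool using (Bool; true; false; not; _∧_; if_then_else_)
open import Data.Bool.Properties using (T-irrelevant; not-injective) renaming (_≟_ to _≟ᵇ_)
open import Data.Integer using (ℤ; +_; 0ℤ) renaming (_+_ to _+ℤ_; _-_ to _-ℤ_)
import Data.Integer.Properties as ℤ
open import Algebra.Properties.AbelianGroup ℤ.+-0-abelianGroup using () renaming (∙-cancelˡ to +ℤ-cancelˡ)
open import Data.List using (List; []; _∷_; _++_; map; filter; length; lookup; allFin; tabulate)
import Data.List.Properties as List
open import Data.List.Membership.Propositional using (_∈_; lose; find)
open import Data.List.Membership.Propositional.Properties
open import Data.List.Relation.Binary.Subset.Propositional using (_⊆_)
open import Data.List.Relation.Unary.Any using (Any; here; there; index)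
import Data.List.Relation.Unary.Any as Any
import Data.List.Relation.Unary.Any.Properties as Any
open import Data.Product using (Σ; ∃; _×_; _,_; proj₁; proj₂)
open import Data.Sum using (_⊎_; inj₁; inj₂)
open import Data.Empty using (⊥-elim)
open import Data.Unit using (⊤; tt)
open import Function using (_∘_; id)
open import Relation.Binary.Definitions using (DecidableEquality)
open import Relation.Binary.PropositionalEquality using (_≡_; _≢_; refl; sym; trans; cong; cong₂; subst)
open import Relation.Nullary using (¬_; Dec; yes; no)
open import Relation.Nullary.Decidable using (True; toWitness; fromWitness; map′; _×-dec_; ¬?; decidable-stable)

-- Checking conditions along a list

-- Later `Q` is `Progress T`: pointwise checks yield either a uniform property or one reason to
-- delete a valuation.
sift : {A Q : Set} {P : A → Set} (xs : List A) →
       (∀ {x} → x ∈ xs → P x ⊎ Q) → (∀ {x} → x ∈ xs → P x) ⊎ Q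
sift [] f = inj₁ λ ()
sift (x ∷ xs) f with f (here refl) | sift xs (f ∘ there)
... | inj₂ q | _ = inj₂ q
... | inj₁ p | inj₂ q = inj₂ q
... | inj₁ p | inj₁ ps = inj₁ λ { (here refl) → p ; (there x∈xs) → ps x∈xs }

map-≡⇒∈ : {A B : Set} {f g : A → B} (xs : List A) →
          map f xs ≡ map g xs → ∀ {x} → x ∈ xs → f x ≡ g x
map-≡⇒∈ (x ∷ xs) eq (here refl) = List.∷-injectiveˡ eq
map-≡⇒∈ (x ∷ xs) eq (there x∈xs) = map-≡⇒∈ xs (List.∷-injectiveʳ eq) x∈xs

∈⇒map-≡ : {A B : Set} {f g : A → B} (xs : List A) →
          (∀ {x} → x ∈ xs → f x ≡ g x) → map f xs ≡ map g xs
∈⇒map-≡ [] eq = refl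
∈⇒map-≡ (x ∷ xs) eq = cong₂ _∷_ (eq (here refl)) (∈⇒map-≡ xs (eq ∘ there))

-- Boolean valuations and propositional consequence

module Propositional {Ag P : Set} where

  Form = Fm Ag P
  Valuation = Form → Bool

  infix 3 _⊨_
  -- A record rather than a bare equation, so that `g` and `φ` stay inferable although `evalB`
  -- computes.
  record _⊨_ (g : Valuation) (φ : Form) : Set where
    constructor ⟨_⟩
    field holds : evalB g φ ≡ true
  open _⊨_ public

  _⊨?_ : ∀ g φ → Dec (g ⊨ φ)
  g ⊨? φ = map′ ⟨_⟩ holds (evalB g φ ≟ᵇ true)

  ⊨-neg⁺ : ∀ {g φ} → ¬ (g ⊨ φ) → g ⊨ neg φ
  ⊨-neg⁺ {g} {φ} h with evalB g φ in eq
  ... | true = ⊥-elim (h ⟨ eq ⟩)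
  ... | false = ⟨ cong not eq ⟩

  ⊨-neg⁻ : ∀ {g φ} → g ⊨ neg φ → ¬ (g ⊨ φ)
  ⊨-neg⁻ {g} {φ} ⟨ h ⟩ ⟨ h′ ⟩ with evalB g φ
  ⊨-neg⁻ ⟨ () ⟩ ⟨ refl ⟩ | _

  ⊨-and⁺ : ∀ {g φ ψ} → g ⊨ φ → g ⊨ ψ → g ⊨ (φ and ψ)
  ⊨-and⁺ ⟨ h ⟩ ⟨ h′ ⟩ = ⟨ cong₂ _∧_ h h′ ⟩

  ⊨-and⁻ : ∀ {g φ ψ} → g ⊨ (φ and ψ) → (g ⊨ φ) × (g ⊨ ψ)
  ⊨-and⁻ {g} {φ} {ψ} ⟨ h ⟩ with evalB g φ in p | evalB g ψ in q
  ... | true | true = ⟨ p ⟩ , ⟨ q ⟩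

  ⊨-imp⁺ : ∀ {g φ ψ} → (g ⊨ φ → g ⊨ ψ) → g ⊨ (φ imp ψ)
  ⊨-imp⁺ f = ⊨-neg⁺ λ h → ⊨-neg⁻ (proj₂ (⊨-and⁻ h)) (f (proj₁ (⊨-and⁻ h)))

  ⊨-imp⁻ : ∀ {g φ ψ} → g ⊨ (φ imp ψ) → g ⊨ φ → g ⊨ ψ
  ⊨-imp⁻ {g} {φ} {ψ} h p =
    decidable-stable (g ⊨? ψ) λ ¬q → ⊨-neg⁻ h (⊨-and⁺ p (⊨-neg⁺ ¬q))

  -- All tautologies are axioms, so propositional derivations reduce to reasoning about an arbitrary
  -- valuation.
  consequence₁ : ∀ {α φ} → (∀ {g} → g ⊨ α → g ⊨ φ) → SSL⊢ α → SSL⊢ φ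
  consequence₁ f p = mp (taut λ g → holds (⊨-imp⁺ (f {g}))) p

  consequence₂ : ∀ {α β φ} → (∀ {g} → g ⊨ α → g ⊨ β → g ⊨ φ) →
                 SSL⊢ α → SSL⊢ β → SSL⊢ φ
  consequence₂ f p = mp (consequence₁ (λ {g} a → ⊨-imp⁺ (f {g} a)) p)

  consequence₃ : ∀ {α β γ φ} → (∀ {g} → g ⊨ α → g ⊨ β → g ⊨ γ → g ⊨ φ) →
                 SSL⊢ α → SSL⊢ β → SSL⊢ γ → SSL⊢ φ
  consequence₃ f p q = mp (consequence₂ (λ {g} a b → ⊨-imp⁺ (f {g} a b)) p q)

  imps : List Form → Form → Form
  imps [] ψ = ψ
  imps (l ∷ ls) ψ = l imp imps ls ψ

  ⊨-imps⁺ : ∀ {g ψ} ls → ((∀ {l} → l ∈ ls → g ⊨ l) → g ⊨ ψ) → g ⊨ imps ls ψ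
  ⊨-imps⁺ [] f = f λ ()
  ⊨-imps⁺ (l ∷ ls) f =
    ⊨-imp⁺ λ p → ⊨-imps⁺ ls λ ps → f λ { (here refl) → p ; (there i) → ps i }

  ⊨-imps⁻ : ∀ {g ψ} ls → g ⊨ imps ls ψ → (∀ {l} → l ∈ ls → g ⊨ l) → g ⊨ ψ
  ⊨-imps⁻ [] h _ = h
  ⊨-imps⁻ (l ∷ ls) h ps = ⊨-imps⁻ ls (⊨-imp⁻ h (ps (here refl))) (ps ∘ there)

  -- By (4), (5) and (S4), agent a knows whether these formulas hold.
  data Modal (a : Ag) : Form → Set where
    isK : ∀ {ψ} → Modal a (K a ψ)
    isS : ∀ {ψ} → Modal a (S a ψ)

  lit : Valuation → Form → Form
  lit w σ = if w σ then σ else neg σ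

  ⊨-lit⁺ : ∀ {a g w σ} → Modal a σ → w σ ≡ g σ → g ⊨ lit w σ
  ⊨-lit⁺ {g = g} {w} {σ} isK eq with w σ
  ... | true = ⟨ sym eq ⟩
  ... | false = ⟨ cong not (sym eq) ⟩
  ⊨-lit⁺ {g = g} {w} {σ} isS eq with w σ
  ... | true = ⟨ sym eq ⟩
  ... | false = ⟨ cong not (sym eq) ⟩

  ⊨-lit⁻ : ∀ {a g w σ} → Modal a σ → g ⊨ lit w σ → w σ ≡ g σ
  ⊨-lit⁻ {w = w} {σ} isK ⟨ h ⟩ with w σ
  ... | true = sym h
  ... | false = sym (not-injective h)
  ⊨-lit⁻ {w = w} {σ} isS ⟨ h ⟩ with w σ
  ... | true = sym h
  ... | false = sym (not-injective h)

  -- Derived modal principles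

  K-mono : ∀ a {φ ψ : Form} → SSL⊢ (φ imp ψ) → SSL⊢ (K a φ imp K a ψ)
  K-mono a p = mp (axK a _ _) (nec a p)

  -- By (T) and (S4), `S a ψ` is equivalent to `K a (S a ψ)`, so negative introspection for it comes
  -- from (5).
  ¬S⇒K¬S : ∀ a ψ → SSL⊢ (neg (S a ψ) imp K a (neg (S a ψ)))
  ¬S⇒K¬S a ψ =
    consequence₃
      (λ t five mono → ⊨-imp⁺ λ ¬s →
        ⊨-imp⁻ mono (⊨-imp⁻ five (⊨-neg⁺ λ ks → ⊨-neg⁻ ¬s (⊨-imp⁻ t ks))))
      (axT a (S a ψ)) (ax5 a (S a ψ))
      (K-mono a (consequence₁ (λ s4 → ⊨-imp⁺ λ ¬ks → ⊨-neg⁺ λ s → ⊨-neg⁻ ¬ks (⊨-imp⁻ s4 s))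
                  (axS4 a ψ)))

  lit⇒K-lit : ∀ {a σ} w → Modal a σ → SSL⊢ (lit w σ imp K a (lit w σ))
  lit⇒K-lit {a} {σ} w isK with w σ
  ... | true = ax4 a _
  ... | false = ax5 a _
  lit⇒K-lit {a} {σ} w isS with w σ
  ... | true = axS4 a _
  ... | false = ¬S⇒K¬S a _

  K-imps : ∀ a {ψ} ls → (∀ {l} → l ∈ ls → SSL⊢ (l imp K a l)) →
           SSL⊢ (K a (imps ls ψ) imp imps ls (K a ψ))
  K-imps a {ψ} [] _ = taut λ g → holds (⊨-imp⁺ {g} {K a ψ} id)
  K-imps a (l ∷ ls) pos =
    consequence₃
      (λ l⇒Kl dist rest → ⊨-imp⁺ λ k → ⊨-imp⁺ λ pl →
        ⊨-imp⁻ rest (⊨-imp⁻ (⊨-imp⁻ dist k) (⊨-imp⁻ l⇒Kl pl)))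
      (pos (here refl)) (axK a l _) (K-imps a ls (pos ∘ there))

  imps-K : ∀ a {ψ} ls → (∀ {l} → l ∈ ls → SSL⊢ (l imp K a l)) →
           SSL⊢ (imps ls ψ) → SSL⊢ (imps ls (K a ψ))
  imps-K a ls pos p = mp (K-imps a ls pos) (nec a p)

  -- Formulas over a finite list of atoms

  module _ (Γ : List Form) where

    -- All modal atoms of the formula that are not below a modality belong to Γ.
    Over : Form → Set
    Over (var p) = var p ∈ Γ
    Over (neg φ) = Over φ
    Over (φ and ψ) = Over φ × Over ψ
    Over (K a φ) = K a φ ∈ Γ
    Over (S a φ) = S a φ ∈ Γ

    -- Keeps the induction of the truth lemma inside `Γ` when it passes below a modality.
    Closed : Form → Set
    Closed (var p) = ⊤
    Closed (neg φ) = ⊤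
    Closed (φ and ψ) = ⊤
    Closed (K a φ) = Over φ
    Closed (S a φ) = Over φ × (∀ b → K b φ ∈ Γ)

    Over-imps : ∀ ls {ψ} → (∀ {l} → l ∈ ls → Over l) → Over ψ → Over (imps ls ψ)
    Over-imps [] _ o = o
    Over-imps (l ∷ ls) os o = os (here refl) , Over-imps ls (os ∘ there) o

    ⊨-agree : ∀ {g h} → (∀ {σ} → σ ∈ Γ → g σ ≡ h σ) →
              ∀ ψ → Over ψ → evalB g ψ ≡ evalB h ψ
    ⊨-agree eq (var p) o = eq o
    ⊨-agree eq (neg ψ) o = cong not (⊨-agree eq ψ o)
    ⊨-agree eq (φ and ψ) (o , o′) = cong₂ _∧_ (⊨-agree eq φ o) (⊨-agree eq ψ o′)
    ⊨-agree eq (K a ψ) o = eq o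
    ⊨-agree eq (S a ψ) o = eq o

    lit-Over : ∀ {a σ} w → Modal a σ → σ ∈ Γ → Over (lit w σ)
    lit-Over {σ = σ} w isK i with w σ
    ... | true = i
    ... | false = i
    lit-Over {σ = σ} w isS i with w σ
    ... | true = i
    ... | false = i

-- Elimination of valuations

module Saturation {k : ℕ} {P : Set} (_≟ᵖ_ : DecidableEquality P) where

  open Propositional {Fin k} {P} public

  _≟_ : DecidableEquality Form
  var p ≟ var q = map′ (cong var) (λ { refl → refl }) (p ≟ᵖ q)
  neg φ ≟ neg ψ = map′ (cong neg) (λ { refl → refl }) (φ ≟ ψ)
  (φ and φ′) ≟ (ψ and ψ′) =
    map′ (λ { (refl , refl) → refl }) (λ { refl → refl , refl }) ((φ ≟ ψ) ×-dec (φ′ ≟ ψ′))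
  K a φ ≟ K b ψ =
    map′ (λ { (refl , refl) → refl }) (λ { refl → refl , refl }) ((a ≟ᶠ b) ×-dec (φ ≟ ψ))
  S a φ ≟ S b ψ =
    map′ (λ { (refl , refl) → refl }) (λ { refl → refl , refl }) ((a ≟ᶠ b) ×-dec (φ ≟ ψ))
  var _ ≟ neg _ = no λ ()
  var _ ≟ (_ and _) = no λ ()
  var _ ≟ K _ _ = no λ ()
  var _ ≟ S _ _ = no λ ()
  neg _ ≟ var _ = no λ ()
  neg _ ≟ (_ and _) = no λ ()
  neg _ ≟ K _ _ = no λ ()
  neg _ ≟ S _ _ = no λ ()
  (_ and _) ≟ var _ = no λ ()
  (_ and _) ≟ neg _ = no λ ()
  (_ and _) ≟ K _ _ = no λ ()
  (_ and _) ≟ S _ _ = no λ ()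
  K _ _ ≟ var _ = no λ ()
  K _ _ ≟ neg _ = no λ ()
  K _ _ ≟ (_ and _) = no λ ()
  K _ _ ≟ S _ _ = no λ ()
  S _ _ ≟ var _ = no λ ()
  S _ _ ≟ neg _ = no λ ()
  S _ _ ≟ (_ and _) = no λ ()
  S _ _ ≟ K _ _ = no λ ()

  modal? : ∀ a σ → Dec (Modal a σ)
  modal? a (var p) = no λ ()
  modal? a (neg σ) = no λ ()
  modal? a (σ and τ) = no λ ()
  modal? a (K b σ) = map′ (λ { refl → isK }) (λ { isK → refl }) (a ≟ᶠ b)
  modal? a (S b σ) = map′ (λ { refl → isS }) (λ { isS → refl }) (a ≟ᶠ b)

  closure : Form → List Form
  closure (var p) = var p ∷ []
  closure (neg φ) = closure φ
  closure (φ and ψ) = closure φ ++ closure ψ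
  closure (K a φ) = K a φ ∷ closure φ
  -- K b φ is needed for every b: condition (SN) is read off from (S2).
  closure (S a φ) = S a φ ∷ map (λ b → K b φ) (allFin k) ++ closure φ

  closure-Over : ∀ {Γ} φ → closure φ ⊆ Γ → Over Γ φ
  closure-Over (var p) s = s (here refl)
  closure-Over (neg φ) s = closure-Over φ s
  closure-Over (φ and ψ) s =
    closure-Over φ (s ∘ ∈-++⁺ˡ) , closure-Over ψ (s ∘ ∈-++⁺ʳ (closure φ))
  closure-Over (K a φ) s = s (here refl)
  closure-Over (S a φ) s = s (here refl)

  closure-Closed : ∀ {Γ} φ → closure φ ⊆ Γ → ∀ {σ} → σ ∈ closure φ → Closed Γ σ
  closure-Closed (var p) s (here refl) = tt
  closure-Closed (neg φ) s i = closure-Closed φ s i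
  closure-Closed (φ and ψ) s i with ∈-++⁻ (closure φ) i
  ... | inj₁ j = closure-Closed φ (s ∘ ∈-++⁺ˡ) j
  ... | inj₂ j = closure-Closed ψ (s ∘ ∈-++⁺ʳ (closure φ)) j
  closure-Closed (K a φ) s (here refl) = closure-Over φ (s ∘ there)
  closure-Closed (K a φ) s (there i) = closure-Closed φ (s ∘ there) i
  closure-Closed {Γ} (S a φ) s i = go i
    where
    Ks = map (λ b → K b φ) (allFin k)

    φ⊆Γ : closure φ ⊆ Γ
    φ⊆Γ = s ∘ there ∘ ∈-++⁺ʳ Ks

    go : ∀ {σ} → σ ∈ closure (S a φ) → Closed Γ σ
    go (here refl) =
      closure-Over φ φ⊆Γ , λ b → s (there (∈-++⁺ˡ (∈-map⁺ (λ b → K b φ) (∈-allFin b))))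
    go (there j) with ∈-++⁻ Ks j
    ... | inj₂ l = closure-Closed φ φ⊆Γ l
    ... | inj₁ l with ∈-map⁻ (λ b → K b φ) l
    ...   | b , _ , refl = closure-Over φ φ⊆Γ

  update : Form → Bool → Valuation → Valuation
  update σ b w τ with τ ≟ σ
  ... | yes _ = b
  ... | no _ = w τ

  -- One valuation for each assignment to `Γ`; by `⊨-agree`, values elsewhere do not affect formulas
  -- over `Γ`.
  valuations : List Form → List Valuation
  valuations [] = (λ _ → false) ∷ []
  valuations (σ ∷ Γ) = map (update σ true) (valuations Γ) ++ map (update σ false) (valuations Γ)

  update-agree : ∀ {Γ σ w} (g : Valuation) → (∀ {τ} → τ ∈ Γ → g τ ≡ w τ) →
                 ∀ {τ} → τ ∈ σ ∷ Γ → g τ ≡ update σ (g σ) w τ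
  update-agree {σ = σ} g eq {τ} i with τ ≟ σ
  ... | yes refl = refl
  update-agree g eq (here refl) | no ¬eq = ⊥-elim (¬eq refl)
  update-agree g eq (there i) | no _ = eq i

  valuations-complete : ∀ Γ (g : Valuation) → ∃ λ (w : Valuation) → w ∈ valuations Γ × (∀ {σ} → σ ∈ Γ → g σ ≡ w σ)
  valuations-complete [] g = _ , here refl , λ ()
  valuations-complete (σ ∷ Γ) g with valuations-complete Γ g
  ... | w , i , eq = update σ (g σ) w , mem (g σ) , update-agree g eq
    where
    mem : ∀ b → update σ b w ∈ valuations (σ ∷ Γ)
    mem true = ∈-++⁺ˡ (∈-map⁺ (update σ true) i)
    mem false = ∈-++⁺ʳ (map (update σ true) (valuations Γ)) (∈-map⁺ (update σ false) i)

  -- Views, profiles and saturation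

  module _ (Γ : List Form) where

    boxes : Fin k → List Form
    boxes a = filter (modal? a) Γ

    -- Equality of views will be the accessibility relation of agent `a`.
    view : Fin k → Valuation → List Bool
    view a w = map w (boxes a)

    -- The view as a list of formulas, which can serve as premises of a derivation.
    profile : Fin k → Valuation → List Form
    profile a w = map (lit w) (boxes a)

    ∈-boxes⁺ : ∀ {a σ} → Modal a σ → σ ∈ Γ → σ ∈ boxes a
    ∈-boxes⁺ {a} m i = ∈-filter⁺ (modal? a) i m

    view-≡ : ∀ {a v w σ} → view a v ≡ view a w → Modal a σ → σ ∈ Γ → v σ ≡ w σ
    view-≡ {a} eq m i = map-≡⇒∈ (boxes a) eq (∈-boxes⁺ m i)

    ∈-profile⁻ : ∀ {a w l} → l ∈ profile a w → ∃ λ σ → l ≡ lit w σ × σ ∈ Γ × Modal a σ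
    ∈-profile⁻ {a} {w} i with ∈-map⁻ (lit w) i
    ... | σ , j , eq with ∈-filter⁻ (modal? a) {xs = Γ} j
    ...   | σ∈Γ , m = σ , eq , σ∈Γ , m

    profile-self : ∀ {a w l} → l ∈ profile a w → w ⊨ l
    profile-self {a} {w} i with ∈-profile⁻ {a} {w} i
    ... | σ , refl , _ , m = ⊨-lit⁺ {w = w} m refl

    profile-view : ∀ {a v w} → (∀ {l} → l ∈ profile a v → w ⊨ l) → view a v ≡ view a w
    profile-view {a} {v} {w} h = ∈⇒map-≡ (boxes a) λ {σ} i →
      ⊨-lit⁻ {w = v} (proj₂ (∈-filter⁻ (modal? a) {xs = Γ} i)) (h (∈-map⁺ (lit v) i))

    profile-K : ∀ a w {l} → l ∈ profile a w → SSL⊢ (l imp K a l)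
    profile-K a w i with ∈-profile⁻ {a} {w} i
    ... | σ , refl , _ , m = lit⇒K-lit w m

    profile-Over : ∀ a w {l} → l ∈ profile a w → Over Γ l
    profile-Over a w i with ∈-profile⁻ {a} {w} i
    ... | σ , refl , j , m = lit-Over Γ w m j

    -- Replaces derivability of the disjunction of the state descriptions of `T`, without writing
    -- that formula.
    Covering : List Valuation → Set
    Covering T = ∀ θ → Over Γ θ → (∀ {w} → w ∈ T → w ⊨ θ) → SSL⊢ θ

    Witness : Fin k → Form → Valuation → Valuation → Set
    Witness a ψ w v = view a w ≡ view a v × ¬ (v ⊨ ψ)

    -- The conditions behind the truth lemma and (SN). In `congruent` the equation `a ≡ b` lets two
    -- members of `Γ` range independently, as `sift-S` requires.
    record Good (T : List Valuation) : Set where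
      field
        reflexive : ∀ {a ψ} → K a ψ ∈ Γ → ∀ {w} → w ∈ T → w ⊨ (K a ψ imp ψ)
        witnesses : ∀ {a ψ} → K a ψ ∈ Γ → ∀ {w} → w ∈ T →
                    (w ⊨ K a ψ) ⊎ Any (Witness a ψ w) T
        known     : ∀ {a ψ} → S a ψ ∈ Γ → ∀ {w} → w ∈ T → w ⊨ (S a ψ imp K a ψ)
        secret    : ∀ {a ψ} → S a ψ ∈ Γ → ∀ {b} → b ∈ allFin k → a ≢ b →
                    ∀ {w} → w ∈ T → w ⊨ (S a ψ imp neg (K b ψ))
        congruent : ∀ {a ψ} → S a ψ ∈ Γ → ∀ {b χ} → S b χ ∈ Γ → a ≡ b →
                    (∀ {w} → w ∈ T → w ⊨ (ψ iff χ)) → ∀ {w} → w ∈ T → w ⊨ (S a ψ iff S b χ)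

    Progress : List Valuation → Set
    Progress T = ∃ λ θ → SSL⊢ θ × Over Γ θ × Any (λ w → ¬ (w ⊨ θ)) T

    enforce : ∀ {T} θ → SSL⊢ θ → Over Γ θ → (∀ {w} → w ∈ T → w ⊨ θ) ⊎ Progress T
    enforce {T} θ ⊢θ o = sift T check
      where
      check : ∀ {w} → w ∈ T → (w ⊨ θ) ⊎ Progress T
      check {w} i with w ⊨? θ
      ... | yes p = inj₁ p
      ... | no ¬p = inj₂ (θ , ⊢θ , o , lose i ¬p)

    -- The equation `σ ≡ K a ψ` makes the sifted predicate vacuous at members of any other shape.
    sift-K : ∀ {Q : Set} {R : Fin k → Form → Set} →
             (∀ {a ψ} → K a ψ ∈ Γ → R a ψ ⊎ Q) → (∀ {a ψ} → K a ψ ∈ Γ → R a ψ) ⊎ Q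
    sift-K {Q} {R} f with sift {P = λ σ → ∀ {a ψ} → σ ≡ K a ψ → R a ψ} Γ check
      where
      check : ∀ {σ} → σ ∈ Γ → (∀ {a ψ} → σ ≡ K a ψ → R a ψ) ⊎ Q
      check {var _} i = inj₁ λ ()
      check {neg _} i = inj₁ λ ()
      check {_ and _} i = inj₁ λ ()
      check {S _ _} i = inj₁ λ ()
      check {K _ _} i with f i
      ... | inj₁ r = inj₁ λ { refl → r }
      ... | inj₂ q = inj₂ q
    ... | inj₁ h = inj₁ λ i → h i refl
    ... | inj₂ q = inj₂ q

    sift-S : ∀ {Q : Set} {R : Fin k → Form → Set} →
             (∀ {a ψ} → S a ψ ∈ Γ → R a ψ ⊎ Q) → (∀ {a ψ} → S a ψ ∈ Γ → R a ψ) ⊎ Q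
    sift-S {Q} {R} f with sift {P = λ σ → ∀ {a ψ} → σ ≡ S a ψ → R a ψ} Γ check
      where
      check : ∀ {σ} → σ ∈ Γ → (∀ {a ψ} → σ ≡ S a ψ → R a ψ) ⊎ Q
      check {var _} i = inj₁ λ ()
      check {neg _} i = inj₁ λ ()
      check {_ and _} i = inj₁ λ ()
      check {K _ _} i = inj₁ λ ()
      check {S _ _} i with f i
      ... | inj₁ r = inj₁ λ { refl → r }
      ... | inj₂ q = inj₂ q
    ... | inj₁ h = inj₁ λ i → h i refl
    ... | inj₂ q = inj₂ q

    module _ (closed : ∀ {σ} → σ ∈ Γ → Closed Γ σ) where

      module _ {T : List Valuation} (cov : Covering T) where

        -- Without a witness against ψ, the profile of w implies ψ at every remaining
        -- valuation, hence derivably so, and then it derivably implies K a ψ.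
        find-witness : ∀ {a ψ} → K a ψ ∈ Γ → ∀ {w} → w ∈ T →
                       ((w ⊨ K a ψ) ⊎ Any (Witness a ψ w) T) ⊎ Progress T
        find-witness {a} {ψ} i {w} w∈T
          with w ⊨? K a ψ
             | Any.any? (λ v → List.≡-dec _≟ᵇ_ (view a w) (view a v) ×-dec ¬? (v ⊨? ψ)) T
        ... | yes p | _ = inj₁ (inj₁ p)
        ... | no _ | yes q = inj₁ (inj₂ q)
        ... | no ¬p | no ¬q = inj₂
          ( imps ls (K a ψ)
          , imps-K a ls (profile-K a w)
              (cov (imps ls ψ) (Over-imps Γ ls (profile-Over a w) (closed i)) implied)
          , Over-imps Γ ls (profile-Over a w) i
          -- The theorem deletes `w` itself, which satisfies its own profile but not `K a ψ`.
          , lose w∈T λ h → ¬p (⊨-imps⁻ ls h (profile-self {a} {w})) )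
          where
          ls = profile a w

          implied : ∀ {v} → v ∈ T → v ⊨ imps ls ψ
          implied {v} v∈T = ⊨-imps⁺ ls λ h → decidable-stable (v ⊨? ψ) λ ¬ψ →
            ¬q (lose v∈T (profile-view {a} {w} h , ¬ψ))

        find-secret : ∀ {a ψ} → S a ψ ∈ Γ → ∀ {b} → b ∈ allFin k →
                      (a ≢ b → ∀ {w} → w ∈ T → w ⊨ (S a ψ imp neg (K b ψ))) ⊎ Progress T
        find-secret {a} {ψ} i {b} _ with a ≟ᶠ b
        ... | yes a≡b = inj₁ λ a≢b → ⊥-elim (a≢b a≡b)
        ... | no a≢b with enforce _ (axS2 a b ψ a≢b) (i , proj₂ (closed i) b)
        ...   | inj₁ h = inj₁ λ _ → h
        ...   | inj₂ q = inj₂ q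

        -- If `ψ` and `χ` agree on all of `T`, covering makes their equivalence a theorem, and the
        -- rule `reS` applies.
        find-congruent : ∀ {a ψ} → S a ψ ∈ Γ → ∀ {b χ} → S b χ ∈ Γ →
                         (a ≡ b → (∀ {w} → w ∈ T → w ⊨ (ψ iff χ)) →
                           ∀ {w} → w ∈ T → w ⊨ (S a ψ iff S b χ)) ⊎ Progress T
        find-congruent {a} {ψ} i {b} {χ} j with a ≟ᶠ b | Any.any? (λ w → ¬? (w ⊨? (ψ iff χ))) T
        ... | no a≢b | _ = inj₁ λ a≡b → ⊥-elim (a≢b a≡b)
        ... | yes _ | yes differ = inj₁ λ _ h →
                let _ , w∈T , ¬iff = find differ in ⊥-elim (¬iff (h w∈T))
        ... | yes refl | no agree
          with enforce _
                 (reS a (cov (ψ iff χ)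
                   ((proj₁ (closed i) , proj₁ (closed j)) , (proj₁ (closed j) , proj₁ (closed i)))
                   (λ {w} w∈T → decidable-stable (w ⊨? (ψ iff χ)) λ ¬iff → agree (lose w∈T ¬iff))))
                 ((i , j) , (j , i))
        ...   | inj₁ h = inj₁ λ _ _ → h
        ...   | inj₂ q = inj₂ q

        good-or-progress : Good T ⊎ Progress T
        good-or-progress
          with sift-K (λ {a} {ψ} i → enforce _ (axT a ψ) (i , closed i))
             | sift-K (λ {a} {ψ} i → sift T (find-witness i))
             | sift-S (λ {a} {ψ} i → enforce _ (axS1 a ψ) (i , proj₂ (closed i) a))
             | sift-S (λ {a} {ψ} i → sift (allFin k) (find-secret i))
             | sift-S (λ {a} {ψ} i → sift-S (find-congruent i))
        ... | inj₂ q | _ | _ | _ | _ = inj₂ q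
        ... | inj₁ _ | inj₂ q | _ | _ | _ = inj₂ q
        ... | inj₁ _ | inj₁ _ | inj₂ q | _ | _ = inj₂ q
        ... | inj₁ _ | inj₁ _ | inj₁ _ | inj₂ q | _ = inj₂ q
        ... | inj₁ _ | inj₁ _ | inj₁ _ | inj₁ _ | inj₂ q = inj₂ q
        ... | inj₁ r | inj₁ w | inj₁ s | inj₁ t | inj₁ c = inj₁ record
          { reflexive = r ; witnesses = w ; known = s ; secret = t ; congruent = c }

        -- If `η` holds wherever `θ` does, then `θ imp η` holds on all of `T` and is derivable;
        -- detach the theorem `θ`.
        covering-filter : ∀ {θ} → SSL⊢ θ → Over Γ θ → Covering (filter (_⊨? θ) T)
        covering-filter {θ} ⊢θ o η o′ h =
          mp (cov (θ imp η) (o , o′) λ i → ⊨-imp⁺ λ p → h (∈-filter⁺ (_⊨? θ) i p)) ⊢θ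

      saturate : ∀ T → Covering T → Acc _<_ (length T) → ∃ λ T′ → Covering T′ × Good T′
      saturate T cov (acc rec) with good-or-progress cov
      ... | inj₁ good = T , cov , good
      ... | inj₂ (θ , ⊢θ , o , fails) =
        saturate (filter (_⊨? θ) T) (covering-filter cov ⊢θ o)
          (rec (List.filter-notAll (_⊨? θ) T fails))

      covering-valuations : Covering (valuations Γ)
      covering-valuations θ o h = taut λ g →
        let w , i , eq = valuations-complete Γ g in trans (⊨-agree Γ eq θ o) (holds (h i))

      saturated : ∃ λ T → Covering T × Good T
      saturated = saturate (valuations Γ) covering-valuations (<-wellFounded _)

-- The simplicial model carried by a saturated list of valuations

module Proper {m n : ℕ} {C : Set} (_≟ᶜ_ : DecidableEquality C)
              (cls : Fin (suc (suc m)) → Fin n → C) where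

  Agent = Fin (suc (suc m))
  World = Fin n × ℤ

  tag : Agent → World → ℤ
  tag zero (i , t) = t
  tag (suc _) (i , t) = t +ℤ + toℕ i

  -- The shift must be undone for every tag `s`, hence integers rather than naturals.
  untag : Agent → Fin n → ℤ → ℤ
  untag zero i s = s
  untag (suc _) i s = s -ℤ + toℕ i

  tag-untag : ∀ a i s → tag a (i , untag a i s) ≡ s
  tag-untag zero i s = refl
  tag-untag (suc _) i s =
    trans (ℤ.+-assoc s _ (+ toℕ i))
      (trans (cong (s +ℤ_) (ℤ.+-inverseˡ (+ toℕ i))) (ℤ.+-identityʳ s))

  -- The first agent fixes `t`, and the second then fixes `i`: here two agents are needed.
  tag-injective : ∀ x y → (∀ a → tag a x ≡ tag a y) → x ≡ y
  tag-injective (i , t) (j , u) eq with eq zero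
  ... | refl = cong (_, t) (toℕ-injective (ℤ.+-injective (+ℤ-cancelˡ t _ _ (eq (suc zero)))))

  -- Restricts to classes that are realised, so every vertex lies in a facet. `True` makes the
  -- evidence proof-irrelevant.
  Occurs : Agent × C × ℤ → Set
  Occurs (a , c , _) = True (any? λ i → cls a i ≟ᶜ c)

  Vertex : Set
  Vertex = Σ (Agent × C × ℤ) Occurs

  colour : Vertex → Agent
  colour ((a , _) , _) = a

  vertex : Agent → World → Vertex
  vertex a x = (a , cls a (proj₁ x) , tag a x) , fromWitness (proj₁ x , refl)

  vertex-≡ : ∀ {u v : Vertex} → proj₁ u ≡ proj₁ v → u ≡ v
  vertex-≡ {p , _} refl = cong (p ,_) (T-irrelevant _ _)

  vertex-cls : ∀ {a x y} → vertex a x ≡ vertex a y → cls a (proj₁ x) ≡ cls a (proj₁ y)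
  vertex-cls eq = cong (λ v → proj₁ (proj₂ (proj₁ v))) eq

  vertex-tag : ∀ {a x y} → vertex a x ≡ vertex a y → tag a x ≡ tag a y
  vertex-tag eq = cong (λ v → proj₂ (proj₂ (proj₁ v))) eq

  -- Adjusts the integer so that `a` sees the old tag at `j`; thus `a` reaches every index of the
  -- same class.
  move : Agent → World → Fin n → World
  move a x j = j , untag a j (tag a x)

  vertex-move : ∀ a x j → cls a (proj₁ x) ≡ cls a j → vertex a x ≡ vertex a (move a x j)
  vertex-move a x j eq =
    vertex-≡ (cong₂ (λ c t → a , c , t) eq (sym (tag-untag a j (tag a x))))

  vertices : World → List Vertex
  vertices x = tabulate λ a → vertex a x

  ∈-vertices : ∀ a x → vertex a x ∈ vertices x
  ∈-vertices a x = ∈-tabulate⁺ {f = λ a → vertex a x} a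

  ∈-vertices⁻ : ∀ {v} x → v ∈ vertices x → v ≡ vertex (colour v) x
  ∈-vertices⁻ x i with ∈-tabulate⁻ {f = λ a → vertex a x} i
  ... | a , refl = refl

  -- Inclusion matches vertices colour by colour, so all tags agree. Hence each `vertices x` is
  -- maximal.
  vertices-⊆ : ∀ x y → vertices x ⊆ vertices y → x ≡ y
  vertices-⊆ x y s = tag-injective x y λ a → vertex-tag (∈-vertices⁻ y (s (∈-vertices a x)))

  Simplex : List Vertex → Set
  Simplex vs = vs ≢ [] × ∃ λ x → vs ⊆ vertices x

  -- Facets and the epistemic model

  module Model (P : Set) (i₀ : Fin n) (val : Fin n → P → Set) where

    x₀ : World
    x₀ = i₀ , 0ℤ

    complex : SimplicialComplex Vertex
    complex = record
      { inhabited = vertex zero x₀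
      ; Face = Simplex
      ; face-exists = vertices x₀ , (λ ()) , x₀ , id
      ; face-nonempty = proj₁
      ; face-closed = λ (_ , x , s) ne s′ → ne , x , s ∘ s′
      }

    open SimplicialComplex complex using (Fac; SameFacet)

    world : Fac → World
    world (_ , (_ , x , _) , _) = x

    ⊆-world : ∀ X → proj₁ X ⊆ vertices (world X)
    ⊆-world (_ , (_ , _ , s) , _) = s

    world-⊆ : ∀ X → vertices (world X) ⊆ proj₁ X
    world-⊆ (_ , (_ , x , s) , max) = max (vertices x) ((λ ()) , x , id) s

    facet : World → Fac
    facet x = vertices x , ((λ ()) , x , id) , λ where
      ys (_ , y , s) s′ → subst (λ z → ys ⊆ vertices z) (sym (vertices-⊆ x y (s ∘ s′))) s

    -- Two lists presenting one facet might carry different worlds; their common vertices exclude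
    -- this.
    world-cong : ∀ X Y → SameFacet X Y → world X ≡ world Y
    world-cong X Y (s , _) = vertices-⊆ (world X) (world Y) (⊆-world Y ∘ s ∘ world-⊆ X)

    vertex-in-facet : ∀ v → Σ Fac λ X → v ∈ proj₁ X
    vertex-in-facet v@((a , c , t) , occ) with toWitness occ
    ... | i , eq = facet x , subst (_∈ vertices x) same (∈-vertices a x)
      where
      x = i , untag a i t
      same : vertex a x ≡ v
      same = vertex-≡ (cong₂ (λ c t → a , c , t) eq (tag-untag a i t))

    epistemic : EpistemicModel Agent P Vertex
    epistemic = record
      { chromatic = record
        { complex = complex
        ; χ = colour
        ; χ-inj = λ { (_ , x , s) i j eq →
            trans (∈-vertices⁻ x (s i))
              (trans (cong (λ a → vertex a x) eq) (sym (∈-vertices⁻ x (s j)))) }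
        }
      ; facet-colours = λ X a → vertex a (world X) , world-⊆ X (∈-vertices a (world X)) , refl
      ; vertex-facet = vertex-in-facet
      ; ν = λ X → val (proj₁ (world X))
      ; ν-ext = λ X Y same p → subst (λ x → val (proj₁ x) p) (world-cong X Y same)
      }

-- Secrecy neighbourhoods, truth lemma and completeness

module Countermodel {m : ℕ} {P : Set} (_≟ᵖ_ : DecidableEquality P) where

  open Saturation {suc (suc m)} _≟ᵖ_

  module _ (Γ : List Form) (closed : ∀ {σ} → σ ∈ Γ → Closed Γ σ)
           (T : List Valuation) (good : Good Γ T) (i₀ : Fin (length T)) where

    open Good good

    valuation : Fin (length T) → Valuation
    valuation = lookup T

    valuation-∈ : ∀ i → valuation i ∈ T
    valuation-∈ i = ∈-lookup i

    open Proper (List.≡-dec _≟ᵇ_) (λ a i → view Γ a (valuation i))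
    open Model P i₀ (λ i p → valuation i ⊨ var p)
    open EpistemicModel epistemic using (Fac; St; _∼[_]_; vtx)

    at : Fac → Valuation
    at X = valuation (proj₁ (world X))

    at-∈ : ∀ X → at X ∈ T
    at-∈ X = valuation-∈ (proj₁ (world X))

    ∼-at : ∀ {a X Y σ} → X ∼[ a ] Y → Modal a σ → σ ∈ Γ → at X σ ≡ at Y σ
    ∼-at {X = X} {Y} eq = view-≡ Γ {v = at X} {at Y} (vertex-cls eq)

    St-vtx : ∀ {v} X → St v X → v ≡ vtx (colour v) X
    St-vtx X i = ∈-vertices⁻ (world X) (⊆-world X i)

    refuting-facet : ∀ {a ψ} → K a ψ ∈ Γ → ∀ X → ¬ (at X ⊨ K a ψ) →
                     Σ Fac λ Y → (X ∼[ a ] Y) × ¬ (at Y ⊨ ψ)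
    refuting-facet {a} {ψ} i X ¬K with witnesses i (at-∈ X)
    ... | inj₁ p = ⊥-elim (¬K p)
    ... | inj₂ q = facet (move a (world X) j) , vertex-move a (world X) j (proj₁ w) , proj₂ w
      where
      j = index q
      w = Any.lookup-result q

    -- `K a ψ` belongs to the view of `a`, so it transfers to `Y`, where (T) applies.
    K-sound : ∀ {a ψ} → K a ψ ∈ Γ → ∀ X → at X ⊨ K a ψ → ∀ Y → X ∼[ a ] Y → at Y ⊨ ψ
    K-sound i X p Y eq =
      ⊨-imp⁻ (reflexive i (at-∈ Y)) ⟨ trans (sym (∼-at {X = X} {Y} eq isK i)) (holds p) ⟩

    model : SecrecyModel (Fin (suc (suc m))) P Vertex
    model = record
      { epistemic = epistemic
      -- The neighbourhoods are the extensions, up to mutual inclusion, of those `ψ` for which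
      -- `S a ψ` holds on the whole star of `v`.
      ; N = λ a v _ U → Σ Form λ ψ → S a ψ ∈ Γ × (∀ X → St v X → at X ⊨ S a ψ) ×
              (∀ Y → U Y → at Y ⊨ ψ) × (∀ Y → at Y ⊨ ψ → U Y)
      ; N-ext = λ { a v _ U U′ f g (ψ , i , s , to , from) →
              ψ , i , s , (λ Y → to Y ∘ g Y) , (λ Y → f Y ∘ from Y) }
      -- (S2) refutes `K b ψ` at `X`, and a witness against it gives the facet outside `U`.
      ; SN = λ { a v _ U (ψ , i , s , to , _) X v∈X b b≢a →
              let Y , eq , ¬ψ = refuting-facet (proj₂ (closed i) b) X
                    (⊨-neg⁻ (⊨-imp⁻ (secret i (∈-allFin b) (b≢a ∘ sym) (at-∈ X)) (s X v∈X)))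
              in Y , eq , ¬ψ ∘ to Y }
      }

    S-at-star : ∀ {a ψ} → S a ψ ∈ Γ → ∀ X → at X ⊨ S a ψ →
                ∀ Y → St (vtx a X) Y → at Y ⊨ S a ψ
    S-at-star i X p Y v∈Y =
      ⟨ trans (sym (∼-at {X = X} {Y} (St-vtx Y v∈Y) isS i)) (holds p) ⟩

    -- Both directions go by mutual induction, since negation exchanges them.
    truth⁺ : ∀ ψ → Over Γ ψ → ∀ X → at X ⊨ ψ → _⊩_ model X ψ
    truth⁻ : ∀ ψ → Over Γ ψ → ∀ X → _⊩_ model X ψ → at X ⊨ ψ

    truth⁺ (var p) o X h = h
    truth⁺ (neg ψ) o X h = ⊨-neg⁻ h ∘ truth⁻ ψ o X
    truth⁺ (φ and ψ) (o , o′) X h =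
      truth⁺ φ o X (proj₁ (⊨-and⁻ h)) , truth⁺ ψ o′ X (proj₂ (⊨-and⁻ h))
    truth⁺ (K a ψ) i X h Y eq = truth⁺ ψ (closed i) Y (K-sound i X h Y eq)
    truth⁺ (S a ψ) i X h =
      (λ Y eq → truth⁺ ψ over Y
        (K-sound (proj₂ (closed i) a) X (⊨-imp⁻ (known i (at-∈ X)) h) Y eq)) ,
      (ψ , i , S-at-star i X h , truth⁻ ψ over , truth⁺ ψ over)
      where over = proj₁ (closed i)

    truth⁻ (var p) o X h = h
    truth⁻ (neg ψ) o X h = ⊨-neg⁺ (h ∘ truth⁺ ψ o X)
    truth⁻ (φ and ψ) (o , o′) X (h , h′) = ⊨-and⁺ (truth⁻ φ o X h) (truth⁻ ψ o′ X h′)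
    truth⁻ (K a ψ) i X h = decidable-stable (at X ⊨? K a ψ) λ ¬K →
      let Y , eq , ¬ψ = refuting-facet i X ¬K in ¬ψ (truth⁻ ψ (closed i) Y (h Y eq))
    -- The neighbourhood comes from some `χ` with the same extension as `ψ`; `congruent` turns
    -- `S a χ` into `S a ψ`.
    truth⁻ (S a ψ) i X (_ , χ , j , s , to , from) =
      ⊨-imp⁻ (proj₁ (⊨-and⁻ (congruent j i refl same (at-∈ X))))
        (s X (world-⊆ X (∈-vertices a (world X))))
      where
      over = proj₁ (closed i)

      same : ∀ {w} → w ∈ T → w ⊨ (χ iff ψ)
      same {w} w∈T = subst (_⊨ (χ iff ψ)) (sym (Any.lookup-index w∈T)) (⊨-and⁺
        (⊨-imp⁺ λ p → truth⁻ ψ over Y (from Y p))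
        (⊨-imp⁺ λ p → to Y (truth⁺ ψ over Y p)))
        -- Every member of `T` occurs at a facet, for any choice of integer, so agreement on facets
        -- is agreement on `T`.
        where Y = facet (index w∈T , 0ℤ)

  complete : ∀ φ → Valid φ → SSL⊢ φ
  complete φ valid with saturated (closure φ) (closure-Closed φ id)
  ... | T , cov , good = cov φ over true-at
    where
    over = closure-Over φ id

    -- The base index of the model is that of the given `w`, so an empty `T` needs no separate case.
    true-at : ∀ {w} → w ∈ T → w ⊨ φ
    true-at w∈T = subst (_⊨ φ) (sym (Any.lookup-index w∈T))
      (truth⁻ (closure φ) (closure-Closed φ id) T good i φ over X
        (valid _ (model (closure φ) (closure-Closed φ id) T good i) X))
      where
      i = index w∈T
      open Proper (List.≡-dec _≟ᵇ_) (λ a j → view (closure φ) a (lookup T j))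
      X = Model.facet P i (λ j p → lookup T j ⊨ var p) (i , 0ℤ)

theorem5p23 : (k : ℕ) → 2 ≤ k → (P : Set) → Countable P →
    (φ : Fm (Fin k) P) → Valid φ → SSL⊢ φ
theorem5p23 (suc (suc m)) (s≤s (s≤s _)) P (f , f-injective) =
  -- Countability gives decidable equality of variables through the injection into ℕ.
  Countermodel.complete λ p q → map′ f-injective (cong f) (f p ℕ.≟ f q)
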